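{- Let $j$ and $k$ be non-negative integers with $k\geq j$, and let $G$ be a graph with girth at least $2j+3$. Then $$\zeta_k(G)\leq \gamma_j(G)+\Delta_j(G).$$
   Context: Graphs are finite, connected, without parallel edges (loops are irrelevant and ignored for girth; an acyclic graph has infinite girth). $\gamma_j(G)$ is the minimum size of a $j$-dominating set of $G$, i.e. a set $S\subseteq V(G)$ such that every vertex $x\notin S$ is at distance at most $j$ from some vertex of $S$. $\Delta_j(G)$ is the maximum, over $u\in V(G)$, of the number of vertices within distance $j$ of $u$ (including $u$ itself). The $k$-visibility Localization game on a finite connected graph $G$ ($k\ge 0$ an integer) with $m$ cops: the robber first chooses a vertex of $G$. Then in each round the cops choose any vertices $u_1,\dots,u_m$ (no restriction relative to earlier placements), and cop $i$ receives the probe $d_i=d(u_i,x)$ if the robber's vertex $x$ satisfies $d(u_i,x)\le k$, and $d_i=\ast$ (no information) otherwise; afterwards the robber moves to a neighboring vertex or stays in place. A candidate is a vertex the robber may occupy, consistent with the information obtained so far. The cops win if they have a strategy that, whatever the robber does, determines after finitely many rounds a unique candidate (the robber is omniscient and knows the cops' entire strategy). The $k$-visibility localization number $\zeta_k(G)$ is the least positive integer $m$ for which $m$ cops have a winning strategy. -}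

module Defs where

open import Data.Bool.Base using (true; false; if_then_else_)
open import Data.Fin.Base using (Fin; zero; suc; inject₁; fromℕ)
import Data.Fin.Properties as Fin
open import Data.Fin.Subset using (Subset; _∈_; _∉_; ∣_∣; ⊤)
open import Data.Fin.Subset.Properties using (_∈?_; ∈⊤; anySubset?)
open import Data.List.Base as List using (List; []; _∷_)
open import Data.List.Extrema.Nat using (max)
import Data.List.Properties as List
open import Data.Maybe.Base using (Maybe; just; nothing)
open import Data.Maybe.Properties using (just-injective)
open import Data.Nat.Base
  using (ℕ; zero; suc; _+_; _≤_; _≤ᵇ_; z≤n; s≤s; NonZero; >-nonZero⁻¹)
open import Data.Nat.Induction using (<-rec)
import Data.Nat.Properties as ℕ
open import Data.Product using (∃; ∃-syntax; ∃!; _×_; _,_; proj₁; proj₂)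
open import Data.Sum.Base using (_⊎_)
open import Data.Vec.Base as Vec using (Vec)
import Data.Vec.Properties as Vec
open import Function.Base using (_∘_; const)
open import Function.Definitions using (Injective)
open import Level using (Level; 0ℓ)
open import Relation.Binary.Core using (Rel)
import Relation.Binary.Definitions as Binary
open import Relation.Binary.PropositionalEquality
open import Relation.Nullary
  using (¬_; yes; no; contradiction; _×-dec_; _→-dec_; ¬?)
open import Relation.Unary using (Pred; Decidable)

private
  variable
    ℓ : Level
    n : ℕ

IsMinimum : Pred ℕ ℓ → Pred ℕ ℓ
IsMinimum P m = P m × (∀ {i} → P i → m ≤ i)

least : {P : Pred ℕ ℓ} → Decidable P → ∀ m → P m → ∃ (IsMinimum P)
least P? zero    p = zero , p , λ _ → z≤n
least P? (suc m) p with P? zero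
... | yes p₀ = zero , p₀ , λ _ → z≤n
... | no ¬p₀ with least (P? ∘ suc) m p
...   | i , q , i≤ = suc i , q ,
  λ { {zero} p₀ → contradiction p₀ ¬p₀ ; {suc _} r → s≤s (i≤ r) }

¬¬-least : {P : Pred ℕ ℓ} → ∃ P → ¬ ¬ ∃ (IsMinimum P)
¬¬-least {P = P} (m , p) ¬min = <-rec (λ m → ¬ P m) step m p
  where
  step : ∀ m → (∀ {i} → suc i ≤ m → ¬ P i) → ¬ P m
  step m ih q = ¬min (m , q , λ r → ℕ.≮⇒≥ λ i<m → ih i<m r)

data Walk (Adj : Rel (Fin n) 0ℓ) : ℕ → Rel (Fin n) 0ℓ where
  stop : ∀ {u} → Walk Adj zero u u
  step : ∀ {l u v w} → Adj u v → Walk Adj l v w → Walk Adj (suc l) u w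

walk? : {Adj : Rel (Fin n) 0ℓ} → Binary.Decidable Adj →
        ∀ l → Binary.Decidable (Walk Adj l)
walk? adj? zero u v with u Fin.≟ v
... | yes refl = yes stop
... | no  u≢v  = no λ { stop → u≢v refl }
walk? adj? (suc l) u w
  with Fin.any? (λ v → adj? u v ×-dec walk? adj? l v w)
... | yes (_ , a , p) = yes (step a p)
... | no  ¬p          = no λ { (step a p) → ¬p (_ , a , p) }

-- Adj is not required to be irreflexive: loops are allowed, and no notion
-- below depends on them.
record Graph : Set₁ where
  field
    order        : ℕ
    {{nonEmpty}} : NonZero order
    Adj          : Rel (Fin order) 0ℓ
    adj?         : Binary.Decidable Adj
    symmetric    : Binary.Symmetric Adj
    connected    : ∀ u v → ∃[ l ] Walk Adj l u v

  V : Set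
  V = Fin order

module _ (G : Graph) where
  open Graph G

  shortestWalk : ∀ u v → ∃ (IsMinimum (λ l → Walk Adj l u v))
  shortestWalk u v =
    least (λ l → walk? adj? l u v) _ (proj₂ (connected u v))

  dist : V → V → ℕ
  dist u v = proj₁ (shortestWalk u v)

  -- A cycle on 3 + l distinct vertices.
  record Cycle (l : ℕ) : Set where
    field
      vertex   : Fin (3 + l) → V
      distinct : Injective _≡_ _≡_ vertex
      edge     : ∀ (i : Fin (2 + l)) → Adj (vertex (inject₁ i)) (vertex (suc i))
      closing  : Adj (vertex (fromℕ (2 + l))) (vertex zero)

  -- Holds for every g if G is acyclic, whose girth is infinite.
  Girth≥ : ℕ → Set
  Girth≥ g = ∀ {l} → Cycle l → g ≤ 3 + l

  Dominating : ℕ → Subset order → Set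
  Dominating j S = ∀ x → x ∉ S → ∃[ s ] s ∈ S × dist x s ≤ j

  dominating? : ∀ j → Decidable (Dominating j)
  dominating? j S = Fin.all? λ x → ¬? (x ∈? S) →-dec
    Fin.any? λ s → (s ∈? S) ×-dec (dist x s ℕ.≤? j)

  smallestDominating :
    ∀ j → ∃ (IsMinimum (λ c → ∃[ S ] Dominating j S × ∣ S ∣ ≡ c))
  smallestDominating j =
    least (λ c → anySubset? λ S → dominating? j S ×-dec (∣ S ∣ ℕ.≟ c))
          ∣ ⊤ {order} ∣ (⊤ , (λ x x∉⊤ → contradiction ∈⊤ x∉⊤) , refl)

  γ : ℕ → ℕ
  γ j = proj₁ (smallestDominating j)

  ball : ℕ → V → Subset order
  ball j u = Vec.tabulate λ v → dist u v ≤ᵇ j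

  Δ : ℕ → ℕ
  Δ j = max 0 (List.map (λ u → ∣ ball j u ∣) (List.allFin order))

  -- nothing stands for the uninformative probe ∗.
  probe : ℕ → V → V → Maybe ℕ
  probe k u x = if dist u x ≤ᵇ k then just (dist u x) else nothing

  -- The infinite itineraries of the robber: position t is where the robber is
  -- when probed in round t, rounds being numbered from 0.
  record Trajectory : Set where
    field
      position : ℕ → V
      move     : ∀ t → position (suc t) ≡ position t
                     ⊎ Adj (position t) (position (suc t))

  open Trajectory public

  -- The probes received so far, the latest round first.  The cops' earlier
  -- placements need not be recorded, since a strategy recovers them.
  History : ℕ → Set
  History m = List (Vec (Maybe ℕ) m)

  Strategy : ℕ → Set
  Strategy m = History m → Vec V m

  module _ (k : ℕ) {m : ℕ} (σ : Strategy m) where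

    history : Trajectory → ℕ → History m
    history x zero    = []
    history x (suc t) =
      Vec.map (λ u → probe k u (position x t)) (σ (history x t)) ∷ history x t

    -- v is a possible position of the robber in round t, given the probes h of
    -- rounds 0 to t.
    Candidate : ℕ → History m → Pred V 0ℓ
    Candidate t h v = ∃[ y ] history y (suc t) ≡ h × position y t ≡ v

    Winning : Set
    Winning = ∀ x → ∃[ t ] ∃! _≡_ (Candidate t (history x (suc t)))

  CopsWin : ℕ → ℕ → Set
  CopsWin k m = ∃[ σ ] Winning k {m} σ

  -- A relation rather than a function, as CopsWin quantifies over infinite
  -- trajectories and is not evidently decidable.
  IsLocalizationNumber : ℕ → ℕ → Set
  IsLocalizationNumber k = IsMinimum (λ m → 1 ≤ m × CopsWin k m)

  dist-refl : ∀ u → dist u u ≡ 0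
  dist-refl u = ℕ.n≤0⇒n≡0 (proj₂ (proj₂ (shortestWalk u u)) stop)

  dist≡0⇒≡ : ∀ {u v} → dist u v ≡ 0 → u ≡ v
  dist≡0⇒≡ {u} {v} eq
    with stop ← subst (λ l → Walk Adj l u v) eq (proj₁ (proj₂ (shortestWalk u v)))
    = refl

  probe-self : ∀ k u → probe k u u ≡ just 0
  probe-self k u rewrite dist-refl u = refl

  probe≡0⇒≡ : ∀ k {u v} → probe k u v ≡ just 0 → u ≡ v
  probe≡0⇒≡ k {u} {v} eq with dist u v ≤ᵇ k
  ... | true  = dist≡0⇒≡ (just-injective eq)
  ... | false = contradiction eq λ ()

  -- Probing every vertex locates the robber in the first round.
  everyVertexWins : ∀ k → CopsWin k order
  everyVertexWins k = σ , λ x → 0 , position x 0 , (x , refl , refl) ,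
    λ { (y , eq , refl) → probe≡0⇒≡ k (located x y (List.∷-injectiveˡ eq)) }
    where
    σ : Strategy order
    σ = const (Vec.allFin order)

    at : ∀ (f : V → Maybe ℕ) u → Vec.lookup (Vec.map f (Vec.allFin order)) u ≡ f u
    at f u = trans (Vec.lookup-map u f (Vec.allFin order))
                   (cong f (Vec.lookup-allFin u))

    located : ∀ x y →
      Vec.map (λ u → probe k u (position y 0)) (Vec.allFin order) ≡
      Vec.map (λ u → probe k u (position x 0)) (Vec.allFin order) →
      probe k (position x 0) (position y 0) ≡ just 0
    located x y eq = begin
      probe k a (position y 0)                                      ≡⟨ at _ a ⟨
      Vec.lookup (Vec.map (λ u → probe k u (position y 0)) (Vec.allFin order)) a
        ≡⟨ cong (λ ps → Vec.lookup ps a) eq ⟩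
      Vec.lookup (Vec.map (λ u → probe k u a) (Vec.allFin order)) a ≡⟨ at _ a ⟩
      probe k a a                                                   ≡⟨ probe-self k a ⟩
      just 0                                                        ∎
      where
      open ≡-Reasoning
      a = position x 0

  -- Classically, every graph has a localization number.
  ¬¬-localizationNumber : ∀ k → ¬ ¬ ∃ (IsLocalizationNumber k)
  ¬¬-localizationNumber k =
    ¬¬-least (order , >-nonZero⁻¹ order , everyVertexWins k)

{-# OPTIONS --safe #-}

-- All the cops win in the second round.  In the first one they probe a minimum
-- j-dominating set S, which shows a probed vertex c with d(c, x₀) minimal, and
-- d(c, x₀) ≤ j ≤ k.  In the second one they probe S and the ball of radius j
-- around c.  A robber outside that ball has moved from x₀ with d(c, x₀) = j to
-- x₁ with d(c, x₁) = j + 1.  Let s ∈ S be within j of x₁.  A second candidate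
-- x₁′ has the same distance to s and, x₀ being probed, is also a neighbour of
-- x₀.  By minimality d(s, x₀) ≥ j, so the geodesics from x₁ and x₁′ to s avoid
-- x₀; with x₀ they contain a cycle of length at most 2j + 2.
module Submission where

open import Defs
open import Data.Nat.Base using (ℕ; _+_; _*_; _≤_; _≥_)
open import Data.Bool.Base using (true; false)
open import Data.Empty using (⊥; ⊥-elim)
open import Data.Fin.Base using (Fin; zero; suc; inject₁; fromℕ; fromℕ<)
import Data.Fin.Properties as Fin
open import Data.Fin.Subset as Subset using (Subset; inside; outside; ∣_∣)
open import Data.Fin.Subset.Properties using (_∈?_)
open import Data.List.Base as List using (_∷_; [])
open import Data.List.Extrema.Nat using (argmin; f[argmin]≤f[xs]; xs≤max)
import Data.List.Membership.Propositional.Properties as List∈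
import Data.List.Properties as List
import Data.List.Relation.Unary.All as All
open import Data.Maybe.Base using (Maybe; just; fromMaybe)
open import Data.Maybe.Properties using (just-injective)
open import Data.Nat.Base using (zero; suc; _<_; _≤ᵇ_; z≤n; s≤s; >-nonZero⁻¹)
import Data.Nat.Properties as ℕ
open import Data.Nat.Tactic.RingSolver using (solve-∀)
open import Data.Product.Base using (∃-syntax; _×_; _,_; proj₁; proj₂)
open import Data.Sum.Base using (_⊎_; [_,_]′)
open import Data.Vec.Base as Vec using (Vec; []; _∷_; lookup; _++_; padRight)
open import Data.Vec.Membership.Propositional using (_∈_)
open import Data.Vec.Membership.Propositional.Properties
  using (∈-map⁺; ∈-++⁺ˡ; ∈-++⁺ʳ)
import Data.Vec.Properties as Vec
open import Data.Vec.Relation.Unary.Any as Any using (here; there)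
import Data.Vec.Relation.Unary.Any.Properties as Any
open import Function.Base using (_∘_; id)
open import Level using (Level; 0ℓ)
open import Relation.Binary.Core using (Rel)
import Relation.Binary.Definitions as Binary
open import Relation.Binary.PropositionalEquality
open import Relation.Nullary using (¬_; yes; no; contradiction; ¬?; _×-dec_)

private
  variable
    a : Level
    A B : Set a
    l m n : ℕ

-- Vectors and enumeration of subsets

∈-padRight⁺ : ∀ (m≤n : m ≤ n) {x y : A} {xs : Vec A m} →
              x ∈ xs → x ∈ padRight m≤n y xs
∈-padRight⁺ (s≤s m≤n) (here eq)  = here eq
∈-padRight⁺ (s≤s m≤n) (there x∈) = there (∈-padRight⁺ m≤n x∈)

map-cong⁻ : ∀ {f g : A → B} {x} {xs : Vec A n} →
            Vec.map f xs ≡ Vec.map g xs → x ∈ xs → f x ≡ g x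
map-cong⁻ eq (here refl) = Vec.∷-injectiveˡ eq
map-cong⁻ eq (there x∈)  = map-cong⁻ (Vec.∷-injectiveʳ eq) x∈

-- The length is `∣ p ∣` by type, so one cop per element uses exactly the number of cops that the
-- bound counts.
elements : (p : Subset n) → Vec (Fin n) ∣ p ∣
elements []            = []
elements (inside ∷ p)  = zero ∷ Vec.map suc (elements p)
elements (outside ∷ p) = Vec.map suc (elements p)

∈-elements : ∀ {x} {p : Subset n} → x Subset.∈ p → x ∈ elements p
∈-elements                   Vec.here       = here refl
∈-elements {p = inside ∷ _}  (Vec.there x∈) = there (∈-map⁺ suc (∈-elements x∈))
∈-elements {p = outside ∷ _} (Vec.there x∈) = ∈-map⁺ suc (∈-elements x∈)

-- Walks, shortest walks and walks avoiding a vertex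

module _ {Adj : Rel (Fin n) 0ℓ} where

  at : ∀ {u v} → Walk Adj l u v → Fin (suc l) → Fin n
  at {u = u} _          zero    = u
  at         (step _ w) (suc i) = at w i

  at-edge : ∀ {u v} (w : Walk Adj l u v) (i : Fin l) →
            Adj (at w (inject₁ i)) (at w (suc i))
  at-edge (step e stop)       zero    = e
  at-edge (step e (step _ _)) zero    = e
  at-edge (step e w)          (suc i) = at-edge w i

  at-end : ∀ {u v} (w : Walk Adj l u v) → at w (fromℕ l) ≡ v
  at-end stop       = refl
  at-end (step _ w) = at-end w

  suffix : ∀ {u v} (w : Walk Adj l u v) i → ∃[ l′ ] l′ ≤ l × Walk Adj l′ (at w i) v
  suffix w          zero    = _ , ℕ.≤-refl , w
  suffix (step _ w) (suc i) with suffix w i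
  ... | l′ , l′≤l , w′ = l′ , ℕ.m≤n⇒m≤1+n l′≤l , w′

  -- Tails of shortest walks are shortest, so only a return to the starting vertex has to be
  -- excluded; there the suffix after the return would be a shorter walk.
  shortest⇒injective : ∀ {u v} (w : Walk Adj l u v) →
                       (∀ {l′} → Walk Adj l′ u v → l ≤ l′) →
                       ∀ {i j} → at w i ≡ at w j → i ≡ j
  shortest⇒injective w          min {zero}  {zero}  eq = refl
  shortest⇒injective (step e w) min {suc i} {suc j} eq =
    cong suc (shortest⇒injective w (ℕ.≤-pred ∘ min ∘ step e) eq)
  shortest⇒injective (step e w) min {zero}  {suc j} refl with suffix w j
  ... | _ , l′≤l , w′ = contradiction (ℕ.≤-trans (min w′) l′≤l) (ℕ.<-irrefl refl)
  shortest⇒injective (step e w) min {suc i} {zero}  refl with suffix w i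
  ... | _ , l′≤l , w′ = contradiction (ℕ.≤-trans (min w′) l′≤l) (ℕ.<-irrefl refl)

  module _ (sym-Adj : Binary.Symmetric Adj) where

    reverseOnto : ∀ {u v w} → Walk Adj l u v → Walk Adj m u w → Walk Adj (l + m) v w
    reverseOnto                             stop       q = q
    reverseOnto {l = suc l} {m} {v = v} {w} (step e p) q =
      subst (λ i → Walk Adj i v w) (ℕ.+-suc l m) (reverseOnto p (step (sym-Adj e) q))

    reverse : ∀ {u v} → Walk Adj l u v → Walk Adj l v u
    reverse {u = u} {v} p = subst (λ i → Walk Adj i v u) (ℕ.+-identityʳ _) (reverseOnto p stop)

-- Deletion of `y` keeps the vertex type and merely isolates `y`, so everything about `Walk` still
-- applies.
_─_ : Rel (Fin n) 0ℓ → Fin n → Rel (Fin n) 0ℓ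
(Adj ─ y) u v = Adj u v × u ≢ y × v ≢ y

-- On meeting `y`, the rest of the walk would lead from `y` to `v` in fewer than `l` steps.
avoids : ∀ {Adj : Rel (Fin n) 0ℓ} {y u v} → u ≢ y →
         (∀ {l′} → l′ < l → ¬ Walk Adj l′ y v) →
         Walk Adj l u v → Walk (Adj ─ y) l u v
avoids u≢y far stop = stop
avoids {y = y} u≢y far (step {v = v} e p) =
  step (e , u≢y , v≢y) (avoids v≢y (far ∘ ℕ.m≤n⇒m≤1+n) p)
  where
  v≢y : v ≢ y
  v≢y refl = far ℕ.≤-refl p

-- The start is excluded separately because the walk of length zero at `y` is also a walk in
-- `Adj ─ y`.
at-≢ : ∀ {Adj : Rel (Fin n) 0ℓ} {y u v} → u ≢ y →
       (w : Walk (Adj ─ y) l u v) → ∀ i → at w i ≢ y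
at-≢ u≢y w                        zero    = u≢y
at-≢ u≢y (step (_ , _ , v≢y) w) (suc i) = at-≢ v≢y w i

-- Distances and short cycles

module _ (G : Graph) where
  open Graph G

  dist≤ : ∀ {u v} → Walk Adj l u v → dist G u v ≤ l
  dist≤ = proj₂ (proj₂ (shortestWalk G _ _))

  geodesic : ∀ u v → Walk Adj (dist G u v) u v
  geodesic u v = proj₁ (proj₂ (shortestWalk G u v))

  dist-sym : ∀ u v → dist G u v ≡ dist G v u
  dist-sym u v = ℕ.≤-antisym (dist≤ (reverse symmetric (geodesic v u)))
                             (dist≤ (reverse symmetric (geodesic u v)))

  dist-step : ∀ u {v w} → Adj v w → dist G u w ≤ suc (dist G u v)
  dist-step u {v} {w} e = begin
    dist G u w       ≡⟨ dist-sym u w ⟩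
    dist G w u       ≤⟨ dist≤ (step (symmetric e) (geodesic v u)) ⟩
    suc (dist G v u) ≡⟨ cong suc (dist-sym v u) ⟩
    suc (dist G u v) ∎
    where open ℕ.≤-Reasoning

  Adj⇒dist≡1 : ∀ {u v} → v ≢ u → Adj u v → dist G u v ≡ 1
  Adj⇒dist≡1 v≢u e = ℕ.≤-antisym (dist≤ (step e stop))
    (ℕ.n≢0⇒n>0 λ eq → v≢u (sym (dist≡0⇒≡ G eq)))

  dist≡1⇒Adj : ∀ {u v} → dist G u v ≡ 1 → Adj u v
  dist≡1⇒Adj {u} {v} eq
    with step e stop ← subst (λ l → Walk Adj l u v) eq (geodesic u v) = e

  dist≡1⇒≢ : ∀ {u v} → dist G u v ≡ 1 → v ≢ u
  dist≡1⇒≢ {u} eq refl with () ← trans (sym (dist-refl G u)) eq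

  -- A shortest walk from `a` to `b` avoiding `y` has no repeated vertex, so it closes up through
  -- `y` to a cycle with two more edges.
  girth≤detour : ∀ {g y a b} → Girth≥ G g → Adj y a → Adj y b → a ≢ y → a ≢ b →
                 Walk (Adj ─ y) l a b → g ≤ 2 + l
  girth≤detour {g = g} {y} {a} {b} girth ya yb a≢y a≢b w =
    detour (least (λ l → walk? ─-dec l a b) _ w)
    where
    ─-dec : Binary.Decidable (Adj ─ y)
    ─-dec u v = adj? u v ×-dec ¬? (u Fin.≟ y) ×-dec ¬? (v Fin.≟ y)

    detour : ∃[ i ] IsMinimum (λ l → Walk (Adj ─ y) l a b) i → g ≤ 2 + _
    detour (zero  , stop , _) = contradiction refl a≢b
    detour (suc i , p , min) = ℕ.≤-trans (girth cycle) (s≤s (s≤s (min w)))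
      where
      -- The `suc i` edges of `p` give `2 + i` vertices, and `y` is one more.
      cycle : Cycle G i
      cycle = record
        { vertex   = vertex
        ; distinct = distinct
        ; edge     = λ { zero → ya ; (suc q) → proj₁ (at-edge p q) }
        ; closing  = subst (λ v → Adj v y) (sym (at-end p)) (symmetric yb)
        }
        where
        vertex : Fin (3 + i) → V
        vertex zero    = y
        vertex (suc q) = at p q

        distinct : ∀ {q r} → vertex q ≡ vertex r → q ≡ r
        distinct {zero}  {zero}  _  = refl
        distinct {zero}  {suc r} eq = contradiction (sym eq) (at-≢ a≢y p r)
        distinct {suc q} {zero}  eq = contradiction eq (at-≢ a≢y p q)
        distinct {suc q} {suc r} eq = cong suc (shortest⇒injective p min eq)

  -- Since `y` is no closer to `s` than `a` and `b` are, neither geodesic to `s` meets `y`. Joined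
  -- at `s` they form a detour of length at most 2j. It may repeat vertices, which `girth≤detour`
  -- allows.
  no-second-route : ∀ {j y a b s} → Girth≥ G (2 * j + 3) →
                    Adj y a → Adj y b → a ≢ y → b ≢ y → a ≢ b →
                    dist G a s ≤ j → dist G b s ≡ dist G a s →
                    dist G a s ≤ dist G y s → ⊥
  no-second-route {j} {y} {a} {b} {s} girth ya yb a≢y b≢y a≢b as≤j bs≡as as≤ys =
    ℕ.<-irrefl refl (begin-strict
      2 + (i + i) <⟨ ℕ.n<1+n _ ⟩
      3 + (i + i) ≤⟨ ℕ.+-monoʳ-≤ 3 (ℕ.+-mono-≤ as≤j as≤j) ⟩
      3 + (j + j) ≡⟨ 3+j+j≡2j+3 j ⟩
      2 * j + 3   ≤⟨ girth≤detour girth ya yb a≢y a≢b route ⟩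
      2 + (i + i) ∎)
    where
    open ℕ.≤-Reasoning
    i = dist G a s

    3+j+j≡2j+3 : ∀ j → 3 + (j + j) ≡ 2 * j + 3
    3+j+j≡2j+3 = solve-∀

    far : ∀ {l} → l < i → ¬ Walk Adj l y s
    far l<i w = ℕ.<⇒≱ l<i (ℕ.≤-trans as≤ys (dist≤ w))

    ─-sym : Binary.Symmetric (Adj ─ y)
    ─-sym (e , u≢y , v≢y) = symmetric e , v≢y , u≢y

    route : Walk (Adj ─ y) (i + i) a b
    route = reverseOnto ─-sym
      (reverse ─-sym (avoids a≢y far (geodesic a s)))
      (reverse ─-sym (avoids b≢y far
        (subst (λ l → Walk Adj l b s) bs≡as (geodesic b s))))

  -- Balls and domination

  ∈-ball : ∀ {j u v} → dist G u v ≤ j → v Subset.∈ ball G j u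
  ∈-ball {j} {u} {v} uv≤j = Vec.lookup⇒[]= v _
    (trans (Vec.lookup∘tabulate (λ v → dist G u v ≤ᵇ j) v) (≤⇒≤ᵇ≡true uv≤j))
    where
    ≤⇒≤ᵇ≡true : ∀ {m n} → m ≤ n → (m ≤ᵇ n) ≡ true
    ≤⇒≤ᵇ≡true {m} {n} m≤n with m ≤ᵇ n | ℕ.≤⇒≤ᵇ m≤n
    ... | true | _ = refl

  ∣ball∣≤Δ : ∀ j u → ∣ ball G j u ∣ ≤ Δ G j
  ∣ball∣≤Δ j u = All.lookup (xs≤max 0 _) (List∈.∈-map⁺ _ (List∈.∈-allFin u))

  dominator : ∀ {j S} → Dominating G j S → ∀ x → ∃[ s ] s Subset.∈ S × dist G x s ≤ j
  dominator {S = S} dom x with x ∈? S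
  ... | yes x∈S = x , x∈S , ℕ.≤-trans (ℕ.≤-reflexive (dist-refl G x)) z≤n
  ... | no  x∉S = dom x x∉S

  -- Probes and the choice of a nearest probed vertex

  module _ (k : ℕ) where

    probe-near : ∀ {u x} → dist G u x ≤ k → probe G k u x ≡ just (dist G u x)
    probe-near {u} {x} ux≤k with dist G u x ≤ᵇ k | ℕ.≤⇒≤ᵇ ux≤k
    ... | true | _ = refl

    probe≡just⇒ : ∀ {u x d} → probe G k u x ≡ just d → dist G u x ≡ d
    probe≡just⇒ {u} {x} eq with dist G u x ≤ᵇ k
    ... | true  = just-injective eq
    ... | false with () ← eq

    probe-dist : ∀ {u x y} → probe G k u y ≡ probe G k u x →
                 dist G u x ≤ k → dist G u y ≡ dist G u x
    probe-dist eq ux≤k = probe≡just⇒ (trans eq (probe-near ux≤k))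

    probe-≡ : ∀ {x y} → probe G k x y ≡ probe G k x x → x ≡ y
    probe-≡ {x} eq = probe≡0⇒≡ G k (trans eq (probe-self G k x))

    -- The default `suc k` exceeds every distance a probe can report, so an uninformative probe
    -- never beats an informative one.
    reading : Maybe ℕ → ℕ
    reading = fromMaybe (suc k)

    reading-near : ∀ {u x d} → d ≤ k → reading (probe G k u x) ≤ d → dist G u x ≤ d
    reading-near {u} {x} d≤k r≤d with dist G u x ≤ᵇ k
    ... | true  = r≤d
    ... | false = contradiction (ℕ.≤-trans r≤d d≤k) (ℕ.<-irrefl refl)

    -- Depends on the probes alone, as the cops do not see the robber; `i₀` is the starting value
    -- that `argmin` requires.
    nearest : Fin m → Vec (Maybe ℕ) m → Fin m
    nearest i₀ ps = argmin (reading ∘ lookup ps) i₀ (List.allFin _)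

    nearest-minimal : ∀ i₀ (us : Vec V m) {u x} → u ∈ us → dist G u x ≤ k →
      dist G (lookup us (nearest i₀ (Vec.map (λ u → probe G k u x) us))) x ≤ dist G u x
    nearest-minimal i₀ us {u} {x} u∈us ux≤k = reading-near ux≤k (begin
      reading (probe G k (lookup us i) x)
        ≡⟨ cong reading (Vec.lookup-map i _ us) ⟨
      reading (lookup ps i)
        ≤⟨ All.lookup (f[argmin]≤f[xs] {f = f} i₀ _) (List∈.∈-allFin i′) ⟩
      reading (lookup ps i′)
        ≡⟨ cong reading (Vec.lookup-map i′ _ us) ⟩
      reading (probe G k (lookup us i′) x)
        ≡⟨ cong (λ v → reading (probe G k v x)) (Any.lookup-index u∈us) ⟨
      reading (probe G k u x)
        ≡⟨ cong reading (probe-near ux≤k) ⟩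
      dist G u x ∎)
      where
      open ℕ.≤-Reasoning
      ps = Vec.map (λ u → probe G k u x) us
      i  = nearest i₀ ps
      i′ = Any.index u∈us
      f  = reading ∘ lookup ps

  -- The strategy and its win in the second round

  module _ {j k : ℕ} (j≤k : j ≤ k) (girth : Girth≥ G (2 * j + 3))
           {S : Subset order} (dom : Dominating G j S) where

    -- Here `x₀` and `x₁` are the robber's first two positions, and `x₁′` is a rival candidate in
    -- the second round. The hypothesis `nearest` is what the first round provides; `same-S` and
    -- `same-ball` are the agreement of the second-round probes.
    located : ∀ {c x₀ x₁ x₁′} → x₁ ≡ x₀ ⊎ Adj x₀ x₁ →
      (∀ {s} → s Subset.∈ S → dist G s x₀ ≤ k → dist G c x₀ ≤ dist G s x₀) →
      (∀ {s} → s Subset.∈ S → probe G k s x₁′ ≡ probe G k s x₁) →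
      (∀ {u} → u Subset.∈ ball G j c → probe G k u x₁′ ≡ probe G k u x₁) →
      x₁ ≡ x₁′
    located {c} {x₀} {x₁} {x₁′} moved nearest same-S same-ball with dist G c x₁ ℕ.≤? j
    -- The vertex `x₁` is itself probed, and only `x₁` is at distance 0 from it.
    ... | yes cx₁≤j = probe-≡ k (same-ball (∈-ball cx₁≤j))
    ... | no  cx₁≰j with x₁ Fin.≟ x₁′ | dominator dom x₀ | dominator dom x₁
    ...   | yes x₁≡x₁′ | _ | _ = x₁≡x₁′
    ...   | no  x₁≢x₁′ | r , r∈S , x₀r≤j | s , s∈S , x₁s≤j = x₁≡x₁′
      where
      open ℕ.≤-Reasoning

      cx₀≤j : dist G c x₀ ≤ j
      cx₀≤j = ℕ.≤-trans (nearest r∈S (ℕ.≤-trans rx₀≤j j≤k)) rx₀≤j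
        where
        rx₀≤j : dist G r x₀ ≤ j
        rx₀≤j = subst (_≤ j) (dist-sym x₀ r) x₀r≤j

      x₁≢x₀ : x₁ ≢ x₀
      x₁≢x₀ refl = cx₁≰j cx₀≤j

      x₀x₁ : Adj x₀ x₁
      x₀x₁ = [ (λ eq → contradiction eq x₁≢x₀) , id ]′ moved

      j≤cx₀ : j ≤ dist G c x₀
      j≤cx₀ = ℕ.≤-pred (ℕ.≤-trans (ℕ.≰⇒> cx₁≰j) (dist-step c x₀x₁))

      sx₁≤k : dist G s x₁ ≤ k
      sx₁≤k = ℕ.≤-trans (subst (_≤ j) (dist-sym x₁ s) x₁s≤j) j≤k

      x₁s≤x₀s : dist G x₁ s ≤ dist G x₀ s
      -- Minimality of `c` compares only with vertices of `S` that see `x₀`; an `s` that does not is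
      -- farther than `k` from `x₀`, yet within `k` of `x₁`.
      x₁s≤x₀s with dist G s x₀ ℕ.≤? k
      ... | yes sx₀≤k = begin
        dist G x₁ s ≤⟨ x₁s≤j ⟩
        j           ≤⟨ j≤cx₀ ⟩
        dist G c x₀ ≤⟨ nearest s∈S sx₀≤k ⟩
        dist G s x₀ ≡⟨ dist-sym s x₀ ⟩
        dist G x₀ s ∎
      ... | no  sx₀≰k = begin
        dist G x₁ s ≡⟨ dist-sym x₁ s ⟩
        dist G s x₁ ≤⟨ sx₁≤k ⟩
        k           ≤⟨ ℕ.<⇒≤ (ℕ.≰⇒> sx₀≰k) ⟩
        dist G s x₀ ≡⟨ dist-sym s x₀ ⟩
        dist G x₀ s ∎

      x₁′s≡x₁s : dist G x₁′ s ≡ dist G x₁ s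
      x₁′s≡x₁s = trans (dist-sym x₁′ s)
        (trans (probe-dist k (same-S s∈S) sx₁≤k) (dist-sym s x₁))

      x₁≡x₁′ : x₁ ≡ x₁′
      -- If `x₁` is `s`, it is probed. Otherwise `1 ≤ k`, so the probe at `x₀` recognises its
      -- neighbours.
      x₁≡x₁′ with x₁ Fin.≟ s
      ... | yes refl = probe-≡ k (same-S s∈S)
      ... | no  x₁≢s = ⊥-elim
        (no-second-route girth x₀x₁ (dist≡1⇒Adj x₀x₁′≡1) x₁≢x₀ (dist≡1⇒≢ x₀x₁′≡1)
          x₁≢x₁′ x₁s≤j x₁′s≡x₁s x₁s≤x₀s)
        where
        1≤k : 1 ≤ k
        1≤k = ℕ.≤-trans (ℕ.n≢0⇒n>0 (x₁≢s ∘ dist≡0⇒≡ G)) (ℕ.≤-trans x₁s≤j j≤k)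

        x₀x₁≡1 : dist G x₀ x₁ ≡ 1
        x₀x₁≡1 = Adj⇒dist≡1 x₁≢x₀ x₀x₁

        x₀x₁′≡1 : dist G x₀ x₁′ ≡ 1
        x₀x₁′≡1 = trans
          (probe-dist k (same-ball (∈-ball cx₀≤j)) (subst (_≤ k) (sym x₀x₁≡1) 1≤k))
          x₀x₁≡1

    module _ (v₀ : V) where

      -- A ball may have fewer than `Δ G j` vertices while the number of cops is fixed; the spare
      -- cops go to `v₀`.
      placement : V → Vec V (∣ S ∣ + Δ G j)
      placement c = elements S ++ padRight (∣ball∣≤Δ j c) v₀ (elements (ball G j c))

      S⊆placement : ∀ c {s} → s Subset.∈ S → s ∈ placement c
      S⊆placement c s∈S = ∈-++⁺ˡ (∈-elements s∈S)

      ball⊆placement : ∀ c {u} → u Subset.∈ ball G j c → u ∈ placement c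
      ball⊆placement c u∈B = ∈-++⁺ʳ (elements S) (∈-padRight⁺ (∣ball∣≤Δ j c) (∈-elements u∈B))

      -- Some vertex of `S` dominates `v₀`, so there is at least one cop. This also gives
      -- `1 ≤ ∣ S ∣ + Δ G j` in `cops-win`.
      i₀ : Fin (∣ S ∣ + Δ G j)
      i₀ = Any.index (S⊆placement v₀ (proj₁ (proj₂ (dominator dom v₀))))

      σ : Strategy G (∣ S ∣ + Δ G j)
      σ []       = placement v₀
      -- `σ h` recovers the placement that produced `ps`, which turns the index of the smallest
      -- reading into a vertex. That vertex need not lie in `S`.
      σ (ps ∷ h) = placement (lookup (σ h) (nearest k i₀ ps))

      σ-wins : Winning G k σ
      σ-wins x = 1 , position x 1 , (x , refl , refl) , λ { (y , eq , refl) → unique y eq }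
        where
        us = placement v₀
        c  = lookup us (nearest k i₀ (Vec.map (λ u → probe G k u (position x 0)) us))

        unique : ∀ y → history G k σ y 2 ≡ history G k σ x 2 → position x 1 ≡ position y 1
        unique y eq = located (move x 0)
          (λ s∈S → nearest-minimal k i₀ us (S⊆placement v₀ s∈S))
          (same ∘ S⊆placement c) (same ∘ ball⊆placement c)
          where
          same : ∀ {u} → u ∈ placement c →
                 probe G k u (position y 1) ≡ probe G k u (position x 1)
          -- Equal first-round probes give equal second placements, so the second-round probes can
          -- be compared cop by cop.
          same = map-cong⁻ (trans
            (cong (λ h → Vec.map (λ u → probe G k u (position y 1)) (σ h))
                  (sym (List.∷-injectiveʳ eq)))
            (List.∷-injectiveˡ eq))

      cops-win : 1 ≤ ∣ S ∣ + Δ G j × CopsWin G k (∣ S ∣ + Δ G j)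
      cops-win = >-nonZero⁻¹ _ {{Fin.nonZeroIndex i₀}} , σ , σ-wins

theorem2 : ∀ (j k : ℕ) → k ≥ j → (G : Graph) → Girth≥ G (2 * j + 3) →
    ∀ ζ → IsLocalizationNumber G k ζ → ζ ≤ γ G j + Δ G j
theorem2 j k k≥j G girth ζ (_ , ζ-least) with smallestDominating G j
-- Matching on `refl` turns `γ G j` into `∣ S ∣`.
... | _ , (S , dom , refl) , _ = ζ-least (cops-win G k≥j girth dom v₀)
  where
  open Graph G
  v₀ : V
  v₀ = fromℕ< (>-nonZero⁻¹ order)
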